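{- Let $t$ be an indeterminate. For every integer $n\ge 0$, $$1+\sum_{k=0}^n t^k \left( L_{k-1} +(t-1)L_{k+1}\right) =t^{n+1}L_{n+1},$$ where $L_k$ ($k\ge 0$) are the Lucas numbers and, by convention in this formula, $L_{ -1}:=0$.
   Context: The Lucas numbers $L_k$ ($k\ge 0$) satisfy $L_{n+2}=L_{n+1}+L_n$ for $n\ge 0$, with $L_0=2$, $L_1=1$. The value $L_{ -1}=0$ is a convention made only for this formula (it is not the value obtained by extending the recurrence backwards). -}

module Defs where

open import Algebra.Bundles.Raw using (RawRing)
open import Data.Integer.Base as ℤ using (ℤ; +_; 0ℤ; 1ℤ)
open import Data.List.Base using (List; []; _∷_; map)
open import Data.Nat.Base as ℕ using (ℕ; zero; suc)
open import Level using (0ℓ)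
open import Relation.Binary.PropositionalEquality.Core using (_≡_)

L : ℕ → ℕ
L 0             = 2
L 1             = 1
L (suc (suc n)) = L (suc n) ℕ.+ L n

-- L[ k -1] is the Lucas number with index k - 1, where L₋₁ is 0 by convention
-- (running the recurrence backwards would give -1 instead).
L[_-1] : ℕ → ℕ
L[ zero  -1] = 0
L[ suc k -1] = L k

-- ℤ[t]: the list a₀ ∷ a₁ ∷ … ∷ aₘ ∷ [] stands for a₀ + a₁ t + … + aₘ tᵐ.
-- Trailing zeros are allowed, so polynomials are compared by coefficients.
Poly : Set
Poly = List ℤ

coeff : Poly → ℕ → ℤ
coeff []      _       = 0ℤ
coeff (a ∷ p) zero    = a
coeff (a ∷ p) (suc i) = coeff p i

infix 4 _≈ᴾ_
_≈ᴾ_ : Poly → Poly → Set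
p ≈ᴾ q = ∀ i → coeff p i ≡ coeff q i

infixl 6 _+ᴾ_
_+ᴾ_ : Poly → Poly → Poly
[]      +ᴾ q       = q
(a ∷ p) +ᴾ []      = a ∷ p
(a ∷ p) +ᴾ (b ∷ q) = (a ℤ.+ b) ∷ (p +ᴾ q)

-- (a + t p) q = a q + t (p q)
infixl 7 _*ᴾ_
_*ᴾ_ : Poly → Poly → Poly
[]      *ᴾ q = []
(a ∷ p) *ᴾ q = map (a ℤ.*_) q +ᴾ (0ℤ ∷ (p *ᴾ q))

const : ℤ → Poly
const a = a ∷ []

t : Poly
t = 0ℤ ∷ 1ℤ ∷ []

ℤ[t] : RawRing 0ℓ 0ℓ
ℤ[t] = record
  { Carrier = Poly
  ; _≈_     = _≈ᴾ_
  ; _+_     = _+ᴾ_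
  ; _*_     = _*ᴾ_
  ; -_      = map (ℤ.-_)
  ; 0#      = []
  ; 1#      = const 1ℤ
  }

open RawRing ℤ[t] public using (_≈_; _+_; _*_; -_; 0#; 1#)
open import Algebra.Definitions.RawSemiring (RawRing.rawSemiring ℤ[t]) public
  using (_^_; sum)

infixl 6 _-_
_-_ : Poly → Poly → Poly
p - q = p + (- q)

{-# OPTIONS --safe #-}

-- The sum telescopes: the k-th summand is tᵏ⁺¹ Lₖ₊₁ − tᵏ Lₖ, because
-- Lₖ₋₁ + (t − 1) Lₖ₊₁ = t Lₖ₊₁ − Lₖ.  For k = 0 this holds with the convention
-- L₋₁ = 0 only if the subtracted term is 1 instead of L₀ = 2; this is the leading 1.
module Submission where

open import Defs
open import Data.Fin.Base using (toℕ)
open import Data.Integer.Base as ℤ using (ℤ; +_; 0ℤ; 1ℤ; -1ℤ)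
import Data.Integer.Properties as ℤ
open import Data.Integer.Tactic.RingSolver using (solve-∀)
open import Data.List.Base using ([]; _∷_; map)
open import Data.Nat.Base using (ℕ; zero; suc)
open import Function.Base using (_∘_)
open import Relation.Binary.PropositionalEquality
  using (_≡_; refl; sym; trans; cong; cong₂; module ≡-Reasoning)

open ≡-Reasoning

-- Equal polynomials may differ as lists by trailing zeros, so identities are reduced to integer
-- identities one coefficient at a time.
coeff-+ : ∀ p q i → coeff (p + q) i ≡ coeff p i ℤ.+ coeff q i
coeff-+ []      q       i       = sym (ℤ.+-identityˡ _)
coeff-+ (a ∷ p) []      i       = sym (ℤ.+-identityʳ _)
coeff-+ (a ∷ p) (b ∷ q) zero    = refl
coeff-+ (a ∷ p) (b ∷ q) (suc i) = coeff-+ p q i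

coeff-scale : ∀ a p i → coeff (map (a ℤ.*_) p) i ≡ a ℤ.* coeff p i
coeff-scale a []      i       = sym (ℤ.*-zeroʳ a)
coeff-scale a (b ∷ p) zero    = refl
coeff-scale a (b ∷ p) (suc i) = coeff-scale a p i

-- The product unfolds to a list of zeros as long as `p`, so it agrees with `[]` only
-- coefficientwise.
*-zeroʳ : ∀ p → p * 0# ≈ 0#
*-zeroʳ []      i       = refl
*-zeroʳ (a ∷ p) zero    = refl
*-zeroʳ (a ∷ p) (suc i) = *-zeroʳ p i

-- p (b + t q) = p b + t (p q): the mirror image of the recursion defining _*_.
coeff-*-∷ : ∀ p b q i →
  coeff (p * (b ∷ q)) i ≡ coeff p i ℤ.* b ℤ.+ coeff (0ℤ ∷ p * q) i
coeff-*-∷ []      b q zero    = refl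
coeff-*-∷ []      b q (suc i) = refl
coeff-*-∷ (a ∷ p) b q zero    = refl
coeff-*-∷ (a ∷ p) b q (suc i) = begin
  coeff (map (a ℤ.*_) q + p * (b ∷ q)) i
    ≡⟨ coeff-+ (map (a ℤ.*_) q) _ i ⟩
  u ℤ.+ coeff (p * (b ∷ q)) i
    ≡⟨ cong₂ ℤ._+_ (refl {x = u}) (coeff-*-∷ p b q i) ⟩
  u ℤ.+ (v ℤ.+ w)
    ≡⟨ exchange u v w ⟩
  v ℤ.+ (u ℤ.+ w)
    ≡⟨ cong₂ ℤ._+_ (refl {x = v}) (coeff-+ (map (a ℤ.*_) q) _ i) ⟨
  v ℤ.+ coeff ((a ∷ p) * q) i
    ∎
  where
  u v w : ℤ
  u = coeff (map (a ℤ.*_) q) i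
  v = coeff p i ℤ.* b
  w = coeff (0ℤ ∷ p * q) i

  exchange : ∀ x y z → x ℤ.+ (y ℤ.+ z) ≡ y ℤ.+ (x ℤ.+ z)
  exchange = solve-∀

coeff-*-const : ∀ p c i → coeff (p * const c) i ≡ coeff p i ℤ.* c
coeff-*-const p c i = begin
  coeff (p * const c) i                           ≡⟨ coeff-*-∷ p c [] i ⟩
  coeff p i ℤ.* c ℤ.+ coeff (0ℤ ∷ p * 0#) i       ≡⟨ cong₂ ℤ._+_ (refl {x = coeff p i ℤ.* c}) (0∷p*0≈0 i) ⟩
  coeff p i ℤ.* c ℤ.+ 0ℤ                          ≡⟨ ℤ.+-identityʳ _ ⟩
  coeff p i ℤ.* c                                 ∎
  where
  0∷p*0≈0 : 0ℤ ∷ p * 0# ≈ 0#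
  0∷p*0≈0 zero    = refl
  0∷p*0≈0 (suc j) = *-zeroʳ p j

-- The product unfolds to 0 p + t (1 p + t 0); the scalings by 0 and 1 and the trailing zero then
-- disappear.
t*p≈0∷p : ∀ p → t * p ≈ 0ℤ ∷ p
t*p≈0∷p p i = begin
  coeff (t * p) i
    ≡⟨ coeff-+ (map (0ℤ ℤ.*_) p) _ i ⟩
  coeff (map (0ℤ ℤ.*_) p) i ℤ.+ coeff (0ℤ ∷ const 1ℤ * p) i
    ≡⟨ cong₂ ℤ._+_ (coeff-scale 0ℤ p i) (0∷1*p≈0∷p i) ⟩
  0ℤ ℤ.+ coeff (0ℤ ∷ p) i
    ≡⟨ ℤ.+-identityˡ _ ⟩
  coeff (0ℤ ∷ p) i
    ∎
  where
  [0]≈0 : const 0ℤ ≈ 0#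
  [0]≈0 zero    = refl
  [0]≈0 (suc j) = refl

  0∷1*p≈0∷p : 0ℤ ∷ const 1ℤ * p ≈ 0ℤ ∷ p
  0∷1*p≈0∷p zero    = refl
  0∷1*p≈0∷p (suc j) = begin
    coeff (const 1ℤ * p) j
      ≡⟨ coeff-+ (map (1ℤ ℤ.*_) p) _ j ⟩
    coeff (map (1ℤ ℤ.*_) p) j ℤ.+ coeff (const 0ℤ) j
      ≡⟨ cong₂ ℤ._+_ (coeff-scale 1ℤ p j) ([0]≈0 j) ⟩
    1ℤ ℤ.* coeff p j ℤ.+ 0ℤ
      ≡⟨ ℤ.+-identityʳ _ ⟩
    1ℤ ℤ.* coeff p j
      ≡⟨ ℤ.*-identityˡ _ ⟩
    coeff p j
      ∎

-- Induction on `n` with `f` and `g` varying: `sum` peels off its first term, which `step 0` merges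
-- with `f 0` into `f 1`, and the hypothesis applies to the shifted sequences.
sum-telescope : ∀ (f g : ℕ → Poly) → (∀ k → f k + g k ≈ f (suc k)) →
  ∀ n → f 0 + sum {n} (g ∘ toℕ) ≈ f n
sum-telescope f g step zero    i = trans (coeff-+ (f 0) [] i) (ℤ.+-identityʳ _)
sum-telescope f g step (suc n) i = begin
  coeff (f 0 + (g 0 + s)) i
    ≡⟨ coeff-+ (f 0) _ i ⟩
  coeff (f 0) i ℤ.+ coeff (g 0 + s) i
    ≡⟨ cong₂ ℤ._+_ (refl {x = coeff (f 0) i}) (coeff-+ (g 0) s i) ⟩
  coeff (f 0) i ℤ.+ (coeff (g 0) i ℤ.+ coeff s i)
    ≡⟨ ℤ.+-assoc (coeff (f 0) i) _ _ ⟨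
  coeff (f 0) i ℤ.+ coeff (g 0) i ℤ.+ coeff s i
    ≡⟨ cong (ℤ._+ coeff s i) (coeff-+ (f 0) (g 0) i) ⟨
  coeff (f 0 + g 0) i ℤ.+ coeff s i
    ≡⟨ cong (ℤ._+ coeff s i) (step 0 i) ⟩
  coeff (f 1) i ℤ.+ coeff s i
    ≡⟨ coeff-+ (f 1) s i ⟨
  coeff (f 1 + s) i
    ≡⟨ sum-telescope (f ∘ suc) (g ∘ suc) (step ∘ suc) n i ⟩
  coeff (f (suc n)) i
    ∎
  where
  s : Poly
  s = sum {n} (g ∘ suc ∘ toℕ)

-- Regroup b + (t - 1) c as (b - c) + t c. Since c = a + b, the constant term is -a, so p a cancels
-- and only t p c remains.
telescoping-step : ∀ p a b → let c = a ℤ.+ b in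
  p * const a + p * (const b + (t - 1#) * const c) ≈ t * p * const c
telescoping-step p a b i = begin
  coeff (p * const a + p * (const b + (t - 1#) * const c)) i
    ≡⟨ coeff-+ (p * const a) _ i ⟩
  coeff (p * const a) i ℤ.+ coeff (p * (const b + (t - 1#) * const c)) i
    ≡⟨ cong₂ ℤ._+_ (coeff-*-const p a i) (coeff-*-∷ p b-c (const c′) i) ⟩
  coeff p i ℤ.* a ℤ.+ (coeff p i ℤ.* b-c ℤ.+ coeff (0ℤ ∷ p * const c′) i)
    ≡⟨ cancel (coeff p i) a b _ ⟩
  coeff (0ℤ ∷ p * const c′) i
    ≡⟨ shift i ⟩
  coeff (0ℤ ∷ p) i ℤ.* c
    ≡⟨ cong (ℤ._* c) (t*p≈0∷p p i) ⟨
  coeff (t * p) i ℤ.* c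
    ≡⟨ coeff-*-const (t * p) c i ⟨
  coeff (t * p * const c) i
    ∎
  where
  -- const b + (t - 1#) * const c evaluates to the list b-c ∷ c′ ∷ [].
  c b-c c′ : ℤ
  c   = a ℤ.+ b
  b-c = b ℤ.+ (-1ℤ ℤ.* c ℤ.+ 0ℤ)
  c′  = 1ℤ ℤ.* c ℤ.+ 0ℤ

  cancel : ∀ x y z w →
    x ℤ.* y ℤ.+ (x ℤ.* (z ℤ.+ (-1ℤ ℤ.* (y ℤ.+ z) ℤ.+ 0ℤ)) ℤ.+ w) ≡ w
  cancel = solve-∀

  shift : ∀ j → coeff (0ℤ ∷ p * const c′) j ≡ coeff (0ℤ ∷ p) j ℤ.* c
  shift zero    = refl
  shift (suc j) = begin
    coeff (p * const c′) j   ≡⟨ coeff-*-const p c′ j ⟩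
    coeff p j ℤ.* c′         ≡⟨ cong (coeff p j ℤ.*_) (trans (ℤ.+-identityʳ _) (ℤ.*-identityˡ c)) ⟩
    coeff p j ℤ.* c          ∎

mainTheorem6 : ∀ (n : ℕ) →
    1# + sum {suc n} (λ i → let k = toℕ i in
    t ^ k * (const (+ L[ k -1]) + (t - 1#) * const (+ L (suc k))))
    ≈ t ^ suc n * const (+ L (suc n))
-- The indices 0 to n give n + 1 terms, hence `suc n`.
mainTheorem6 n = sum-telescope partialSum summand step (suc n)
  where
  summand : ℕ → Poly
  summand k = t ^ k * (const (+ L[ k -1]) + (t - 1#) * const (+ L (suc k)))

  partialSum : ℕ → Poly
  partialSum zero    = 1#
  partialSum (suc k) = t ^ suc k * const (+ L (suc k))

  step : ∀ k → partialSum k + summand k ≈ partialSum (suc k)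
  -- With L₋₁ = 0 and L₁ = 1 this is 1 + (t - 1) = t, between explicit lists whose coefficients
  -- evaluate.
  step zero    zero                = refl
  step zero    (suc zero)          = refl
  step zero    (suc (suc zero))    = refl
  step zero    (suc (suc (suc i))) = refl
  -- Here a = Lₖ₊₁ and b = Lₖ, so c is Lₖ₊₂ by the defining recurrence: `+ (m ℕ.+ n)` and
  -- `+ m ℤ.+ + n` agree by computation.
  step (suc k)                     =
    telescoping-step (t ^ suc k) (+ L (suc k)) (+ L k)
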